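{- Let $(G,\beta)$ be an edge-labeled graph on vertices $v_1,\dots,v_n$, with module $m_j\mathbb{Z}$ at $v_j$ and module $\mathbb{Z}/r_{jl}\mathbb{Z}$ at each edge $v_jv_l$. For each $i=1,\dots,n$, let $\mathcal{P}^i$ be the set of the longest paths $P_{ji}$ of $v_i$ in $(G,\beta)$, and for each $P_{ji}\in\mathcal{P}^i$, with vertices in order starting from $v_i$, let $F_k=(f_{kv_i},f_{kv_{j_1}},\dots,f_{kv_{j_t}})$ be a minimal spline with $f_{kv_i}\neq0$ on $(P_{ji},\beta_{ji})$, where $\beta_{ji}=\beta|_{P_{ji}}$ (here $k$ indexes the longest paths in $\mathcal{P}^i$). Let $B=\{F^{(1)},\dots,F^{(n)}\}$ be a set of flow-up classes on $(G,\beta)$ where each $F^{(i)}=(0,\dots,0,f^{(i)}_{v_i},\dots,f^{(i)}_{v_n})\in\hat{\mathcal{F}}_i$ is minimal with the first nonzero entry $f^{(i)}_{v_i}$ equal to the least common multiple of all the $f_{kv_i}$, for $i=1,2,\dots,n$. Then $B$ forms a module basis over $\mathbb{Z}$ for $\hat{R}_G$.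
   Context: Setting: $G$ is a finite graph with ordered vertex set $\{v_1,\dots,v_n\}$, whose edges are unordered pairs of distinct vertices. Each vertex $v_j$ carries the $\mathbb{Z}$-module $m_j\mathbb{Z}$ ($m_j\in\mathbb{Z}$) and each edge $v_jv_l$ the $\mathbb{Z}$-module $\beta(v_jv_l)=\mathbb{Z}/r_{jl}\mathbb{Z}$ ($r_{jl}=r_{lj}\in\mathbb{Z}$). A spline on $(G,\beta)$ is a tuple of integers $(f_{v_1},\dots,f_{v_n})$ with $f_{v_j}\in m_j\mathbb{Z}$ for all $j$ and $f_{v_j}\equiv f_{v_l}\pmod{r_{jl}}$ for every edge $v_jv_l$; the $\mathbb{Z}$-module of all splines is $\hat{R}_G$. An $i$-th flow-up class is a spline with $f_{v_i}\ne0$ and $f_{v_s}=0$ for $s<i$; the set of these is $\hat{\mathcal{F}}_i$. The leading term of an element of $\hat{\mathcal{F}}_i$ is its entry at $v_i$; the leading terms of elements of $\hat{\mathcal{F}}_i$ (together with $0$) form an ideal of $\mathbb{Z}$, and $F^{(i)}\in\hat{\mathcal{F}}_i$ is minimal if its leading term generates this ideal. Longest paths: a trail from $v_j$ to $v_i$ is an ordered sequence of vertices and edges from $v_j$ to $v_i$ with no repeated edge, regarded as a path graph (so its vertices are distinct). A longest path $P_{ji}$ of $v_i$ is a trail ending at $v_i$ (starting from some vertex $v_j$) that is maximal under strict inclusion among all trails in $G$ ending at $v_i$. Minimal spline on a longest path $P_{ji}$ of $v_i$: order the vertices of $P_{ji}$ starting from its end $v_i$. A spline on $P_{ji}$ (with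 the vertex modules and edge labels inherited from $(G,\beta)$) with nonzero entry at $v_i$ is minimal if its entry at $v_i$ generates the ideal of $\mathbb{Z}$ consisting of all entries at $v_i$ of splines on $P_{ji}$. -}

module Defs where

open import Algebra.Bundles using (Ring)
open import Algebra.Module.Bundles using (LeftModule)
import Algebra.Definitions.RawMonoid as RawMonoidDefs
open import Data.Fin.Base using (Fin; zero; suc; toℕ; _<_)
open import Data.Integer.Base using (ℤ; 0ℤ; _+_; _*_; _-_; -_)
open import Data.Integer.Divisibility.Signed
  using (_∣_; divides; ∣m∣n⇒∣m+n; ∣m⇒∣-m; ∣n⇒∣m*n)
open import Data.Integer.Properties
open import Data.Integer.Tactic.RingSolver using (solve-∀)
open import Data.Nat.Base using (ℕ)
import Data.Nat.Properties as ℕ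
open import Data.Product.Base using (Σ; ∃; ∃₂; _×_; _,_)
open import Data.Sum.Base using (_⊎_; inj₁; inj₂; swap)
open import Data.Vec.Functional using (Vector)
open import Function.Definitions using (Injective)
open import Level using (Level; 0ℓ; _⊔_)
open import Relation.Binary.Core using (Rel)
open import Relation.Binary.Definitions using (Symmetric; Irreflexive; Decidable)
open import Relation.Binary.PropositionalEquality
  using (_≡_; _≢_; _≗_; refl; sym; trans; cong; cong₂; subst)
open import Relation.Nullary using (¬_)
open import Relation.Nullary.Decidable using (_⊎-dec_)
open import Relation.Unary using (Pred; _≐_)

------------------------------------------------------------------------
-- Bases of modules

module _ {r ℓr m ℓm : Level} {R : Ring r ℓr} (M : LeftModule R m ℓm) where
  open Ring R using (Carrier; _≈_; 0#)
  open LeftModule M using (Carrierᴹ; _≈ᴹ_; _*ₗ_; 0ᴹ; +ᴹ-rawMonoid)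
  open RawMonoidDefs +ᴹ-rawMonoid using (sum)

  linearCombination : ∀ {n} → Vector Carrier n → Vector Carrierᴹ n → Carrierᴹ
  linearCombination c b = sum (λ i → c i *ₗ b i)

  LinearlyIndependent : ∀ {n} → Vector Carrierᴹ n → Set (r ⊔ ℓr ⊔ ℓm)
  LinearlyIndependent {n} b =
    (c : Vector Carrier n) → linearCombination c b ≈ᴹ 0ᴹ → ∀ i → c i ≈ 0#

  Spanning : ∀ {n} → Vector Carrierᴹ n → Set (r ⊔ m ⊔ ℓm)
  Spanning {n} b =
    (x : Carrierᴹ) → Σ (Vector Carrier n) λ c → x ≈ᴹ linearCombination c b

  IsBasis : ∀ {n} → Vector Carrierᴹ n → Set (r ⊔ ℓr ⊔ m ⊔ ℓm)
  IsBasis b = LinearlyIndependent b × Spanning b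

------------------------------------------------------------------------
-- Ideals of ℤ and least common multiples

Generates : ℤ → Pred ℤ 0ℓ → Set
Generates x I = I ≐ (x ∣_)

-- Least in the order of divisibility.  As always in a ring this fixes x
-- only up to a unit, so both lcm and - lcm qualify; the generator of an
-- ideal is likewise determined only up to sign.
IsLCM : {K : Set} → (K → ℤ) → ℤ → Set
IsLCM f x = (∀ k → f k ∣ x) × (∀ y → (∀ k → f k ∣ y) → x ∣ y)

------------------------------------------------------------------------
-- Edge-labeled graphs and splines

-- The vertex v carries the module (m v)ℤ and the edge vw the module
-- ℤ/(r v w)ℤ.  The values of r at non-adjacent pairs play no role.
record EdgeLabeledGraph (n : ℕ) : Set₁ where
  field
    Adj        : Rel (Fin n) 0ℓ
    adj-sym    : Symmetric Adj
    adj-irrefl : Irreflexive _≡_ Adj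
    adj?       : Decidable Adj
    m          : Fin n → ℤ
    r          : Fin n → Fin n → ℤ
    r-sym      : ∀ {v w} → Adj v w → r v w ≡ r w v

module _ {n : ℕ} (G : EdgeLabeledGraph n) where
  open EdgeLabeledGraph G

  record Spline : Set where
    constructor spline
    field
      entry     : Vector ℤ n
      in-module : ∀ v → m v ∣ entry v
      congruent : ∀ {v w} → Adj v w → r v w ∣ entry v - entry w

  open Spline

  splineModule : LeftModule +-*-ring 0ℓ 0ℓ
  splineModule = record
    { Carrierᴹ = Spline
    ; _≈ᴹ_     = λ f g → entry f ≗ entry g
    ; _+ᴹ_     = λ f g → spline
        (λ v → entry f v + entry g v)
        (λ v → ∣m∣n⇒∣m+n (in-module f v) (in-module g v))
        (λ {v} {w} e → subst (r v w ∣_)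
          (sub-+ (entry f v) (entry f w) (entry g v) (entry g w))
          (∣m∣n⇒∣m+n (congruent f e) (congruent g e)))
    ; _*ₗ_     = λ a f → spline
        (λ v → a * entry f v)
        (λ v → ∣n⇒∣m*n a (in-module f v))
        (λ {v} {w} e → subst (r v w ∣_)
          (sub-* a (entry f v) (entry f w))
          (∣n⇒∣m*n a (congruent f e)))
    ; 0ᴹ       = spline (λ _ → 0ℤ) (λ _ → divides 0ℤ refl)
                   (λ _ → divides 0ℤ refl)
    ; -ᴹ_      = λ f → spline
        (λ v → - entry f v)
        (λ v → ∣m⇒∣-m (in-module f v))
        (λ {v} {w} e → subst (r v w ∣_)
          (sub-neg (entry f v) (entry f w))
          (∣m⇒∣-m (congruent f e)))
    ; isLeftModule = record
      { isLeftSemimodule = record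
        { +ᴹ-isCommutativeMonoid = record
          { isMonoid = record
            { isSemigroup = record
              { isMagma = record
                { isEquivalence = record
                  { refl  = λ _ → refl
                  ; sym   = λ p v → sym (p v)
                  ; trans = λ p q v → trans (p v) (q v)
                  }
                ; ∙-cong = λ p q v → cong₂ _+_ (p v) (q v)
                }
              ; assoc = λ f g h v → +-assoc (entry f v) (entry g v) (entry h v)
              }
            ; identity = (λ f v → +-identityˡ (entry f v))
                       , (λ f v → +-identityʳ (entry f v))
            }
          ; comm = λ f g v → +-comm (entry f v) (entry g v)
          }
        ; isPreleftSemimodule = record
          { *ₗ-cong      = λ p q v → cong₂ _*_ p (q v)
          ; *ₗ-zeroˡ     = λ f v → *-zeroˡ (entry f v)
          ; *ₗ-distribʳ  = λ f a b v → *-distribʳ-+ (entry f v) a b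
          ; *ₗ-identityˡ = λ f v → *-identityˡ (entry f v)
          ; *ₗ-assoc     = λ a b f v → *-assoc a b (entry f v)
          ; *ₗ-zeroʳ     = λ a v → *-zeroʳ a
          ; *ₗ-distribˡ  = λ a f g v → *-distribˡ-+ a (entry f v) (entry g v)
          }
        }
      ; -ᴹ‿cong    = λ p v → cong -_ (p v)
      ; -ᴹ‿inverse = (λ f v → +-inverseˡ (entry f v))
                   , (λ f v → +-inverseʳ (entry f v))
      }
    }
    where
    sub-+ : ∀ a b c d → (a - b) + (c - d) ≡ (a + c) - (b + d)
    sub-+ = solve-∀
    sub-* : ∀ a b c → a * (b - c) ≡ a * b - a * c
    sub-* = solve-∀
    sub-neg : ∀ a b → - (a - b) ≡ - a - - b
    sub-neg = solve-∀

  IsFlowUp : Fin n → Spline → Set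
  IsFlowUp i f = entry f i ≢ 0ℤ × (∀ s → s < i → entry f s ≡ 0ℤ)

  LeadingTerms : Fin n → Pred ℤ 0ℓ
  LeadingTerms i a = a ≡ 0ℤ ⊎ ∃ λ f → IsFlowUp i f × entry f i ≡ a

  IsMinimalFlowUp : Fin n → Spline → Set
  IsMinimalFlowUp i f = IsFlowUp i f × Generates (entry f i) (LeadingTerms i)

  EntriesAt : Fin n → Pred ℤ 0ℓ
  EntriesAt i a = ∃ λ (f : Spline) → entry f i ≡ a

  IsMinimalAt : Fin n → Spline → Set
  IsMinimalAt i f = entry f i ≢ 0ℤ × Generates (entry f i) (EntriesAt i)

------------------------------------------------------------------------
-- Longest paths

Consecutive : ∀ {k} → Rel (Fin k) 0ℓ
Consecutive a b = toℕ b ≡ ℕ.suc (toℕ a)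

PathAdj : ∀ {k} → Rel (Fin k) 0ℓ
PathAdj a b = Consecutive a b ⊎ Consecutive b a

module _ {n : ℕ} (G : EdgeLabeledGraph n) where
  open EdgeLabeledGraph G

  -- Vertices are listed backwards, beginning with the end i of the trail;
  -- the starting vertex is the last one listed.  In a graph without
  -- multiple edges the edges are determined by the vertices, and distinct
  -- vertices force distinct edges.  Length 0 (the single vertex i) is allowed.
  record Trail (i : Fin n) : Set where
    field
      length   : ℕ
      vertex   : Fin (ℕ.suc length) → Fin n
      end      : vertex zero ≡ i
      distinct : Injective _≡_ _≡_ vertex
      adjacent : ∀ {a b} → Consecutive a b → Adj (vertex a) (vertex b)

    VertexOf : Pred (Fin n) 0ℓ
    VertexOf v = ∃ λ a → vertex a ≡ v

    EdgeOf : Rel (Fin n) 0ℓ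
    EdgeOf v w = ∃₂ λ a b → PathAdj a b × vertex a ≡ v × vertex b ≡ w

  open Trail

  _⊆ᵀ_ : ∀ {i} → Rel (Trail i) 0ℓ
  P ⊆ᵀ Q = (∀ {v} → VertexOf P v → VertexOf Q v)
         × (∀ {v w} → EdgeOf P v w → EdgeOf Q v w)

  _⊂ᵀ_ : ∀ {i} → Rel (Trail i) 0ℓ
  P ⊂ᵀ Q = P ⊆ᵀ Q × ¬ (Q ⊆ᵀ P)

  record LongestPath (i : Fin n) : Set where
    field
      trail   : Trail i
      maximal : ∀ (Q : Trail i) → ¬ (trail ⊂ᵀ Q)

  pathGraph : ∀ {i} (P : Trail i) → EdgeLabeledGraph (ℕ.suc (length P))
  pathGraph P = record
    { Adj        = PathAdj
    ; adj-sym    = swap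
    ; adj-irrefl = λ where
        refl (inj₁ e) → ℕ.1+n≢n (sym e)
        refl (inj₂ e) → ℕ.1+n≢n (sym e)
    ; adj?       = λ a b →
        (toℕ b ℕ.≟ ℕ.suc (toℕ a)) ⊎-dec (toℕ a ℕ.≟ ℕ.suc (toℕ b))
    ; m          = λ a → m (vertex P a)
    ; r          = λ a b → r (vertex P a) (vertex P b)
    ; r-sym      = λ where
        (inj₁ e) → r-sym (adjacent P e)
        (inj₂ e) → sym (r-sym (adjacent P e))
    }

  PathSpline : ∀ {i} → LongestPath i → Set
  PathSpline P = Spline (pathGraph (LongestPath.trail P))

  -- Position zero of the path is the vertex i.
  IsMinimalOnPath : ∀ {i} (P : LongestPath i) → PathSpline P → Set
  IsMinimalOnPath P = IsMinimalAt (pathGraph (LongestPath.trail P)) zero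

{-# OPTIONS --safe #-}

-- Listed row by row, flow-up classes form an upper triangular integer matrix
-- with nonzero diagonal, which gives independence.  Spanning is Gaussian
-- elimination: a spline that vanishes before v_i has an entry at v_i that is
-- either 0 or a leading term, hence a multiple of the diagonal entry there.
module Submission where

open import Defs
open import Algebra.Module.Bundles using (LeftModule)
import Algebra.Properties.Monoid.Sum as MonoidSum
open import Data.Fin.Base using (Fin; zero; suc; _<_)
open import Data.Integer.Base using (ℤ; 0ℤ; _+_; _*_; _-_)
open import Data.Integer.Divisibility.Signed using (_∣_; divides)
open import Data.Integer.Properties
open import Data.Integer.Tactic.RingSolver using (solve-∀)
open import Data.Nat.Base as ℕ using (ℕ)
open import Data.Product.Base using (Σ; ∃; _×_; _,_; proj₁; proj₂)
open import Data.Sum.Base using (inj₁; inj₂)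
open import Data.Vec.Functional using (Vector; tail; _∷_)
open import Function.Base using (_∘_)
open import Level using (0ℓ)
open import Relation.Binary.PropositionalEquality
open import Relation.Nullary using (yes; no; contradiction)
open import Relation.Unary using (Pred; _∈_)

open MonoidSum +-0-monoid using (sum; sum-cong-≗; sum-replicate-zero)
open Spline
open ≡-Reasoning

UpperTriangular : ∀ {n} → Vector (Vector ℤ n) n → Set
UpperTriangular a = ∀ i s → s < i → a i s ≡ 0ℤ

combination : ∀ {k n} → Vector ℤ k → Vector (Vector ℤ n) k → Vector ℤ n
combination c a s = sum (λ i → c i * a i s)

minor : ∀ {n} → Vector (Vector ℤ (ℕ.suc n)) (ℕ.suc n) → Vector (Vector ℤ n) n
minor a i = tail (a (suc i))

minor-triangular : ∀ {n} (a : Vector (Vector ℤ (ℕ.suc n)) (ℕ.suc n)) →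
  UpperTriangular a → UpperTriangular (minor a)
minor-triangular a tri i s s<i = tri (suc i) (suc s) (ℕ.s≤s s<i)

combination-head : ∀ {n} (c : Vector ℤ (ℕ.suc n)) a → UpperTriangular a →
  combination c a zero ≡ c zero * a zero zero
combination-head {n} c a tri = begin
  c zero * a zero zero + sum (λ i → c (suc i) * a (suc i) zero)
    ≡⟨ cong (c zero * a zero zero +_) (sum-cong-≗ λ i →
         trans (cong (c (suc i) *_) (tri (suc i) zero (ℕ.s≤s ℕ.z≤n)))
               (*-zeroʳ (c (suc i)))) ⟩
  c zero * a zero zero + sum {n} (λ _ → 0ℤ)
    ≡⟨ cong (c zero * a zero zero +_) (sum-replicate-zero n) ⟩
  c zero * a zero zero + 0ℤ
    ≡⟨ +-identityʳ _ ⟩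
  c zero * a zero zero ∎

-- Induction on the size. In column zero the relation reads `c zero * a zero zero ≡ 0ℤ`, and ℤ has
-- no zero divisors, so `c zero` vanishes; the other columns then give a relation among the rows of
-- `minor a`.
triangular⇒independent : ∀ {n} (a : Vector (Vector ℤ n) n) →
  UpperTriangular a → (∀ i → a i i ≢ 0ℤ) →
  ∀ c → combination c a ≗ (λ _ → 0ℤ) → ∀ i → c i ≡ 0ℤ
triangular⇒independent {ℕ.suc n} a tri diag c eq = vanish
  where
  c₀≡0 : c zero ≡ 0ℤ
  c₀≡0 with i*j≡0⇒i≡0∨j≡0 (c zero) (trans (sym (combination-head c a tri)) (eq zero))
  ... | inj₁ p = p
  ... | inj₂ q = contradiction q (diag zero)

  tail-eq : combination (tail c) (minor a) ≗ (λ _ → 0ℤ)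
  tail-eq s = begin
    combination (tail c) (minor a) s
      -- `0ℤ * _` computes to `0ℤ`, so the left identity law alone inserts the term of row zero.
      ≡⟨ +-identityˡ _ ⟨
    0ℤ * a zero (suc s) + combination (tail c) (minor a) s
      ≡⟨ cong (λ z → z * a zero (suc s) + combination (tail c) (minor a) s) c₀≡0 ⟨
    combination c a (suc s)
      ≡⟨ eq (suc s) ⟩
    0ℤ ∎

  vanish : ∀ i → c i ≡ 0ℤ
  vanish zero    = c₀≡0
  vanish (suc i) = triangular⇒independent (minor a) (minor-triangular a tri)
                     (diag ∘ suc) (tail c) tail-eq i

ClosedUnderReduction : ∀ {n} → Pred (Vector ℤ n) 0ℓ → Set
ClosedUnderReduction S =
  ∀ {x y} q → x ∈ S → y ∈ S → (λ s → x s - q * y s) ∈ S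

LeadingDivides : ∀ {n} → Vector (Vector ℤ n) n → Pred (Vector ℤ n) 0ℓ → Set
LeadingDivides a S =
  ∀ i {x} → x ∈ S → (∀ s → s < i → x s ≡ 0ℤ) → a i i ∣ x i

-- The head must be zero so that a tail vanishing before `i` comes from a member of `S` vanishing
-- before `suc i`; this carries `LeadingDivides` over to the minor.
TailsOf : ∀ {n} → Pred (Vector ℤ (ℕ.suc n)) 0ℓ → Pred (Vector ℤ n) 0ℓ
TailsOf S y = ∃ λ x → x ∈ S × x zero ≡ 0ℤ × tail x ≗ y

-- Subtracting a multiple of row zero clears the head of `x`, and induction treats the tail. The set
-- `S` is arbitrary because the recursive call replaces it by `TailsOf S`.
triangular⇒spanning : ∀ {n} (a : Vector (Vector ℤ n) n) (S : Pred (Vector ℤ n) 0ℓ) →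
  UpperTriangular a → ClosedUnderReduction S → (∀ i → a i ∈ S) → LeadingDivides a S →
  ∀ x → x ∈ S → Σ (Vector ℤ n) λ c → x ≗ combination c a
triangular⇒spanning {ℕ.zero}  a S tri closed rows lead x x∈S = (λ ()) , λ ()
triangular⇒spanning {ℕ.suc n} a S tri closed rows lead x x∈S
  -- No index precedes zero, so the vanishing condition is vacuous. The quotient `q` becomes the
  -- coefficient of row zero.
  with lead zero x∈S (λ _ ())
... | divides q x₀≡ = q ∷ proj₁ rest , spans
  where
  reduced : Vector ℤ (ℕ.suc n)
  reduced s = x s - q * a zero s

  closed′ : ClosedUnderReduction (TailsOf S)
  closed′ p (x , x∈S , x₀ , x≗) (y , y∈S , y₀ , y≗) =
    _ , closed p x∈S y∈S
      , trans (cong₂ (λ u v → u - p * v) x₀ y₀) (cong (λ u → 0ℤ - u) (*-zeroʳ p))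
      , λ s → cong₂ (λ u v → u - p * v) (x≗ s) (y≗ s)

  lead′ : LeadingDivides (minor a) (TailsOf S)
  lead′ i (x , x∈S , x₀ , x≗) zeros =
    subst (a (suc i) (suc i) ∣_) (x≗ i) (lead (suc i) x∈S λ where
      zero    _             → x₀
      (suc s) (ℕ.s≤s s<i) → trans (x≗ s) (zeros s s<i))

  rest : Σ (Vector ℤ n) λ c → tail reduced ≗ combination c (minor a)
  rest = triangular⇒spanning (minor a) (TailsOf S) (minor-triangular a tri) closed′
    (λ i → a (suc i) , rows (suc i) , tri (suc i) zero (ℕ.s≤s ℕ.z≤n) , λ _ → refl)
    lead′ (tail reduced)
    ( reduced , closed q x∈S (rows zero)
    , trans (cong (_- q * a zero zero) x₀≡) (+-inverseʳ (q * a zero zero))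
    , λ _ → refl)

  restore : ∀ u v → u ≡ v + (u - v)
  restore = solve-∀

  spans : x ≗ combination (q ∷ proj₁ rest) a
  spans zero    = trans x₀≡ (sym (combination-head (q ∷ proj₁ rest) a tri))
  spans (suc s) = trans (restore (x (suc s)) (q * a zero (suc s)))
                        (cong (q * a zero (suc s) +_) (proj₂ rest s))

module _ {n : ℕ} (G : EdgeLabeledGraph n) where
  open LeftModule (splineModule G) using (_+ᴹ_; -ᴹ_; _*ₗ_)

  -- Translates sums in `splineModule G` into sums of integers, so that the matrix lemmas apply to
  -- splines.
  entry-linearCombination : ∀ {k} (c : Vector ℤ k) (F : Vector (Spline G) k) →
    entry (linearCombination (splineModule G) c F) ≗ combination c (entry ∘ F)
  entry-linearCombination {ℕ.zero}  c F s = refl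
  entry-linearCombination {ℕ.suc k} c F s =
    cong (c zero * entry (F zero) s +_) (entry-linearCombination (tail c) (tail F) s)

  -- Stated up to `≗`, which is also the equality of `splineModule G`.
  IsEntries : Pred (Vector ℤ n) 0ℓ
  IsEntries x = ∃ λ (g : Spline G) → entry g ≗ x

  entries-closed : ClosedUnderReduction IsEntries
  entries-closed q (g , g≗) (h , h≗) =
    (g +ᴹ (-ᴹ (q *ₗ h))) , λ s → cong₂ (λ u v → u - q * v) (g≗ s) (h≗ s)

  minimal⇒leadingDivides : (F : Fin n → Spline G) →
    (∀ i → IsMinimalFlowUp G i (F i)) → LeadingDivides (entry ∘ F) IsEntries
  -- Minimality enters here, through the inclusion of the leading terms in the multiples of
  -- `entry (F i) i`.
  minimal⇒leadingDivides F min i {x} (g , g≗) zeros = proj₁ (proj₂ (min i)) leading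
    where
    leading : LeadingTerms G i (x i)
    leading with x i ≟ 0ℤ
    ... | yes x≡0 = inj₁ x≡0
    ... | no  x≢0 = inj₂ (g , ((λ g≡0 → x≢0 (trans (sym (g≗ i)) g≡0))
                              , λ s s<i → trans (g≗ s) (zeros s s<i)) , g≗ i)

  minimalFlowUps⇒basis : (F : Fin n → Spline G) →
    (∀ i → IsMinimalFlowUp G i (F i)) → IsBasis (splineModule G) F
  minimalFlowUps⇒basis F min = independent , spanning
    where
    triangular : UpperTriangular (entry ∘ F)
    triangular i = proj₂ (proj₁ (min i))

    independent : LinearlyIndependent (splineModule G) F
    independent c eq = triangular⇒independent (entry ∘ F) triangular
      (λ i → proj₁ (proj₁ (min i))) c
      (λ s → trans (sym (entry-linearCombination c F s)) (eq s))

    spanning : Spanning (splineModule G) F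
    spanning g =
      let c , eq = triangular⇒spanning (entry ∘ F) IsEntries triangular entries-closed
            (λ i → F i , λ _ → refl) (minimal⇒leadingDivides F min)
            (entry g) (g , λ _ → refl)
      in c , λ s → trans (eq s) (sym (entry-linearCombination c F s))

theorem6p14 : ∀ {n : ℕ} (G : EdgeLabeledGraph n)
    (f : (i : Fin n) (P : LongestPath G i) → PathSpline G P) →
    (∀ i P → IsMinimalOnPath G P (f i P)) →
    (F : Fin n → Spline G) →
    (∀ i → IsMinimalFlowUp G i (F i)) →
    (∀ i → IsLCM (λ P → Spline.entry (f i P) zero) (Spline.entry (F i) i)) →
    IsBasis (splineModule G) F
theorem6p14 G _ _ F minimal _ = minimalFlowUps⇒basis G F minimal
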